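{- There is a constant $c>0$ such that for every unit interval graph $G=(V,E)$ with $N=|V|\ge 2$ nodes, labeled $v_0,\dots,v_{N-1}$ in increasing order of the left endpoints of their intervals, the minimal $\pi$-OBDD representing $\chi_E$ has at most $c\,N/\log N$ nodes, where $\pi$ is the $2$-interleaved variable order with decreasing significance.
   Context: A unit interval graph on $N$ nodes is given by intervals $[a_i,a_i+1]$, $0\le i\le N-1$; two distinct nodes are adjacent iff their intervals intersect. Without loss of generality all endpoints are distinct, and the nodes are labeled so that $a_0<a_1<\dots<a_{N-1}$. Let $n=\lceil\log_2 N\rceil$. For $x=(x_0,\dots,x_{n-1})\in\{0,1\}^n$ put $|x|=\sum_{i=0}^{n-1}x_i2^i$. The characteristic function $\chi_E:\{0,1\}^{2n}\to\{0,1\}$ is defined by $\chi_E(x,y)=1$ iff $|x|,|y|<N$ and $\{v_{|x|},v_{|y|}\}\in E$. A $\pi$-OBDD for a variable order $\pi$ (a linear order of the input variables) is a directed acyclic rooted graph with two sinks labeled $0$ and $1$. Every inner node is labeled by a variable and has two outgoing edges labeled $0$ and $1$, and along every edge the variables respect $\pi$. An assignment determines a path from the root by following, at each node labeled $x_i$, the edge labeled by the value of $x_i$. The OBDD represents $f$ if this path always ends in the sink labeled $f(\text{assignment})$. The size of an OBDD is its number of nodes. The $2$-interleaved variable order with decreasing significance on $x,y\in\{0,1\}^n$ is $(x_{n-1},y_{n-1},x_{n-2},y_{n-2},\dots,x_0,y_0)$. -}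

module Defs where

open import Data.Bool.Base using (Bool; true; false; if_then_else_)
open import Data.Fin.Base as Fin using (Fin; toℕ; fromℕ<; opposite)
open import Data.Nat.Base as ℕ using (ℕ)
import Data.Nat.Properties as ℕ
open import Data.Product using (∃; _×_; _,_)
open import Data.Rational.Base as ℚ using (ℚ; 1ℚ)
import Data.Rational.Properties as ℚ
open import Data.Sum using (_⊎_; inj₁; inj₂)
open import Data.Vec.Base using (Vec; lookup; sum; tabulate)
open import Function.Bundles using (_⇔_; mk⇔; Equivalence)
open import Level using (0ℓ)
open import Relation.Binary.Core using (Rel)
open import Relation.Binary.Definitions using (Decidable)
open import Relation.Binary.PropositionalEquality
open import Relation.Nullary using (¬_; does; yes; no)

------------------------------------------------------------------------
-- Real numbers: two-sided Dedekind cuts of ℚ.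

record ℝ : Set₁ where
  field
    L U         : ℚ → Set
    L-inhabited : ∃ L
    U-inhabited : ∃ U
    L-rounded   : ∀ q → L q ⇔ ∃ λ r → q ℚ.< r × L r
    U-rounded   : ∀ r → U r ⇔ ∃ λ q → q ℚ.< r × U q
    disjoint    : ∀ q → ¬ (L q × U q)
    located     : ∀ {q r} → q ℚ.< r → L q ⊎ U r

infix 4 _≤ᵣ_

_≤ᵣ_ : ℝ → ℝ → Set
x ≤ᵣ y = ∀ q → ℝ.L x q → ℝ.L y q

private
  q+1-1 : ∀ q → (q ℚ.+ 1ℚ) ℚ.- 1ℚ ≡ q
  q+1-1 q = begin
    (q ℚ.+ 1ℚ) ℚ.- 1ℚ   ≡⟨ ℚ.+-assoc q 1ℚ (ℚ.- 1ℚ) ⟩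
    q ℚ.+ (1ℚ ℚ.- 1ℚ)   ≡⟨ cong (q ℚ.+_) (ℚ.+-inverseʳ 1ℚ) ⟩
    q ℚ.+ ℚ.0ℚ          ≡⟨ ℚ.+-identityʳ q ⟩
    q                   ∎
    where open ≡-Reasoning

  q-1+1 : ∀ q → (q ℚ.- 1ℚ) ℚ.+ 1ℚ ≡ q
  q-1+1 q = begin
    (q ℚ.- 1ℚ) ℚ.+ 1ℚ       ≡⟨ ℚ.+-assoc q (ℚ.- 1ℚ) 1ℚ ⟩
    q ℚ.+ (ℚ.- 1ℚ ℚ.+ 1ℚ)   ≡⟨ cong (q ℚ.+_) (ℚ.+-inverseˡ 1ℚ) ⟩
    q ℚ.+ ℚ.0ℚ              ≡⟨ ℚ.+-identityʳ q ⟩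
    q                       ∎
    where open ≡-Reasoning

infixl 6 _+1

_+1 : ℝ → ℝ
x +1 = record
  { L           = λ q → L (q ℚ.- 1ℚ)
  ; U           = λ q → U (q ℚ.- 1ℚ)
  ; L-inhabited = let q , Lq = L-inhabited in q ℚ.+ 1ℚ , subst L (sym (q+1-1 q)) Lq
  ; U-inhabited = let q , Uq = U-inhabited in q ℚ.+ 1ℚ , subst U (sym (q+1-1 q)) Uq
  ; L-rounded   = λ q → mk⇔
      (λ Lq → let r , q-1<r , Lr = Equivalence.to (L-rounded _) Lq in
        r ℚ.+ 1ℚ
        , subst (ℚ._< r ℚ.+ 1ℚ) (q-1+1 q) (ℚ.+-monoˡ-< 1ℚ q-1<r)
        , subst L (sym (q+1-1 r)) Lr)
      (λ (r , q<r , Lr) → Equivalence.from (L-rounded _)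
        (r ℚ.- 1ℚ , ℚ.+-monoˡ-< (ℚ.- 1ℚ) q<r , Lr))
  ; U-rounded   = λ r → mk⇔
      (λ Ur → let q , q<r-1 , Uq = Equivalence.to (U-rounded _) Ur in
        q ℚ.+ 1ℚ
        , subst (q ℚ.+ 1ℚ ℚ.<_) (q-1+1 r) (ℚ.+-monoˡ-< 1ℚ q<r-1)
        , subst U (sym (q+1-1 q)) Uq)
      (λ (q , q<r , Uq) → Equivalence.from (U-rounded _)
        (q ℚ.- 1ℚ , ℚ.+-monoˡ-< (ℚ.- 1ℚ) q<r , Uq))
  ; disjoint    = λ q → disjoint (q ℚ.- 1ℚ)
  ; located     = λ q<r → located (ℚ.+-monoˡ-< (ℚ.- 1ℚ) q<r)
  }
  where open ℝ x

------------------------------------------------------------------------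
-- Unit interval graphs

infix 4 _∈[_,_]

_∈[_,_] : ℝ → ℝ → ℝ → Set
p ∈[ a , b ] = (a ≤ᵣ p) × (p ≤ᵣ b)

-- Node i is vᵢ, with interval [aᵢ , aᵢ + 1].  Distinctness of the
-- endpoints, a normalisation without loss of generality, is not
-- required: the labelling only has to be sorted by left endpoint, ties
-- being broken arbitrarily.  Every representation with
-- a₀ < a₁ < … < a_{N-1} is covered.
--
-- Intersection of real intervals is not constructively decidable, whereas
-- a graph has a {0,1}-valued adjacency function; hence _~?_.
record UnitIntervalGraph (N : ℕ) : Set₁ where
  infix 4 _~_ _~?_
  field
    a      : Fin N → ℝ
    sorted : ∀ i j → i Fin.≤ j → a i ≤ᵣ a j
    _~_    : Rel (Fin N) 0ℓ
    _~?_   : Decidable _~_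
    ~⇔     : ∀ i j →
             (i ~ j) ⇔ (i ≢ j × ∃ λ p → p ∈[ a i , a i +1 ] × p ∈[ a j , a j +1 ])

------------------------------------------------------------------------
-- The characteristic function of the edge set

bit : Bool → ℕ
bit b = if b then 1 else 0

∣_∣ : ∀ {n} → Vec Bool n → ℕ
∣ x ∣ = sum (tabulate λ i → bit (lookup x i) ℕ.* 2 ℕ.^ toℕ i)

χ : ∀ {N n} → UnitIntervalGraph N → Vec Bool n → Vec Bool n → Bool
χ {N} G x y with ∣ x ∣ ℕ.<? N | ∣ y ∣ ℕ.<? N
... | yes x<N | yes y<N = does (fromℕ< x<N ~? fromℕ< y<N)
  where open UnitIntervalGraph G
... | _       | _       = false

------------------------------------------------------------------------
-- Variables and variable orders

data Var (n : ℕ) : Set where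
  𝕩 𝕪 : Fin n → Var n

assignment : ∀ {n} → Vec Bool n → Vec Bool n → Var n → Bool
assignment x y (𝕩 i) = lookup x i
assignment x y (𝕪 i) = lookup y i

-- Position in the sequence x_{n-1}, y_{n-1}, …, x₀, y₀;
-- toℕ (opposite i) = n - 1 - i.
position : ∀ {n} → Var n → ℕ
position (𝕩 i) = 2 ℕ.* toℕ (opposite i)
position (𝕪 i) = 2 ℕ.* toℕ (opposite i) ℕ.+ 1

Interleaved : ∀ n → Rel (Var n) 0ℓ
Interleaved n u v = position u ℕ.< position v

------------------------------------------------------------------------
-- OBDDs

data Node (k : ℕ) : Set where
  sink  : Bool → Node k
  inner : Fin k → Node k

record Inner (n k : ℕ) : Set where
  constructor mkInner
  field
    var : Var n
    lo  : Node k   -- target of the edge labelled 0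
    hi  : Node k   -- target of the edge labelled 1

open Inner public

-- Since the strict linear order _≺_ increases along every edge between
-- inner nodes, the graph is acyclic.
record OBDD {n} (_≺_ : Rel (Var n) 0ℓ) : Set where
  field
    k      : ℕ
    root   : Node k
    inners : Vec (Inner n k) k

  at : Fin k → Inner n k
  at = lookup inners

  field
    lo-ordered : ∀ u v → lo (at u) ≡ inner v → var (at u) ≺ var (at v)
    hi-ordered : ∀ u v → hi (at u) ≡ inner v → var (at u) ≺ var (at v)

  -- The inner nodes and the two sinks.
  size : ℕ
  size = k ℕ.+ 2

  data Reaches (α : Var n → Bool) : Node k → Bool → Set where
    done : ∀ {b} → Reaches α (sink b) b
    step : ∀ {u b} →
           Reaches α (if α (var (at u)) then hi (at u) else lo (at u)) b →
           Reaches α (inner u) b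

open OBDD public using (size)

module _ {n} {_≺_ : Rel (Var n) 0ℓ} where

  Represents : OBDD _≺_ → (Vec Bool n → Vec Bool n → Bool) → Set
  Represents B f = ∀ x y → Reaches (assignment x y) root (f x y)
    where open OBDD B

  IsMinimal : OBDD _≺_ → (Vec Bool n → Vec Bool n → Bool) → Set
  IsMinimal B f = Represents B f × (∀ B′ → Represents B′ f → size B ℕ.≤ size B′)

{-# OPTIONS --safe #-}

-- Closeness of the left endpoints makes χ the symmetrisation of a staircase:
-- for x < y, v x and v y are adjacent iff y ≤ r x with r monotone.  After the
-- leading bits of x and y have been read, what remains is a square block of
-- the adjacency matrix, and equal blocks share an OBDD node.
--   * With R² blocks, only O(R) are not constant, because the boundary of a
--     staircase meets each antidiagonal of blocks in at most one block.
--   * A block of side m is determined by its boundary, a lattice path, so there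
--     are O(4^m) of them.
-- Using the first bound while m exceeds about n / 4, and the second one below,
-- gives O(2^n / n) nodes.  Minimal diagrams exist by exhaustive search.

module Submission where

open import Defs
open import Data.Bool.Base using (Bool; true; false; if_then_else_)
import Data.Bool.Properties as Bool
open import Data.Fin.Base using (Fin; zero; suc; toℕ; fromℕ; fromℕ<; inject₁; opposite; combine; remQuot; cast; splitAt; _↑ˡ_; _↑ʳ_)
open import Data.Fin.Induction using (<-weakInduction)
open import Data.Fin.Properties as Fin using (any?; all?; toℕ<n; combine-injective; fromℕ<-injective; opposite-prop; toℕ-inject₁; toℕ-fromℕ; toℕ-fromℕ<; fromℕ<-toℕ; toℕ-cast; toℕ-combine; toℕ-injective; remQuot-combine; splitAt-↑ˡ; splitAt-↑ʳ)
open import Data.Nat.Base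
open import Data.Nat.Logarithm using (⌈log₂_⌉; ⌈log₂⌉-mono-≤; ⌈log₂2^n⌉≡n)
open import Data.Nat.Properties
open import Data.Nat.Tactic.RingSolver using (solve-∀)
open import Data.Product using (Σ-syntax; ∃; ∃-syntax; _×_; _,_; proj₁; proj₂)
import Data.Rational.Base as ℚ
import Data.Rational.Properties as ℚ
open import Data.Sum.Base using (_⊎_; inj₁; inj₂; [_,_]′)
open import Data.Vec.Base using (Vec; []; _∷_; lookup; tabulate; sum)
open import Data.Vec.Properties using (lookup∘tabulate)
open import Function.Base using (_∘_; case_of_)
open import Function.Bundles using (Equivalence; mk⇔)
open import Relation.Binary.Definitions using (tri<; tri≈; tri>)
open import Relation.Binary.PropositionalEquality
open import Relation.Nullary using (¬_; Dec; yes; no; does; contradiction)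
open import Relation.Nullary.Decidable using (map′; ¬?; dec-true; decidable-stable; _→-dec_; _×-dec_)
open import Relation.Unary using (Decidable)

-- Minimal OBDDs by exhaustive search

-- Finiteness is expressed as decidability of existence, which passes through surjections, sums,
-- products and vectors without any listing of elements.
Searchable : Set → Set₁
Searchable A = ∀ {P : A → Set} → Decidable P → Dec (∃ P)

search-image : ∀ {A B : Set} (f : A → B) → (∀ b → ∃[ a ] f a ≡ b) → Searchable A → Searchable B
search-image f surj search {P} P? = map′
  (λ (a , p) → f a , p)
  (λ (b , p) → let a , fa≡b = surj b in a , subst P (sym fa≡b) p)
  (search (P? ∘ f))

search-× : ∀ {A B : Set} → Searchable A → Searchable B → Searchable (A × B)
search-× searchA searchB P? = map′
  (λ (a , b , p) → (a , b) , p)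
  (λ ((a , b) , p) → a , b , p)
  (searchA λ a → searchB λ b → P? (a , b))

search-⊎ : ∀ {A B : Set} → Searchable A → Searchable B → Searchable (A ⊎ B)
search-⊎ searchA searchB P? with searchA (P? ∘ inj₁) | searchB (P? ∘ inj₂)
... | yes (a , p) | _           = yes (inj₁ a , p)
... | no _        | yes (b , p) = yes (inj₂ b , p)
... | no ¬a       | no ¬b       = no λ where
  (inj₁ a , p) → ¬a (a , p)
  (inj₂ b , p) → ¬b (b , p)

search-Vec : ∀ {A : Set} → Searchable A → ∀ n → Searchable (Vec A n)
search-Vec search zero P? = map′ ([] ,_) (λ { ([] , p) → p }) (P? [])
search-Vec search (suc n) = search-image
  (λ (a , as) → a ∷ as) (λ { (a ∷ as) → (a , as) , refl })
  (search-× search (search-Vec search n))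

search-Bool : Searchable Bool
search-Bool = search-image {A = Fin 2}
  (λ { zero → false ; (suc zero) → true })
  (λ { false → zero , refl ; true → suc zero , refl })
  any?

search-∀ : ∀ {A : Set} → Searchable A → {P : A → Set} → Decidable P → Dec (∀ a → P a)
search-∀ search P? = map′
  (λ ¬∃ a → decidable-stable (P? a) λ ¬p → ¬∃ (a , ¬p))
  (λ p (a , ¬p) → ¬p (p a))
  (¬? (search (¬? ∘ P?)))

search-Var : ∀ n → Searchable (Var n)
search-Var n = search-image [ 𝕩 , 𝕪 ]′
  (λ { (𝕩 i) → inj₁ i , refl ; (𝕪 i) → inj₂ i , refl })
  (search-⊎ any? any?)

search-Node : ∀ k → Searchable (Node k)
search-Node k = search-image [ sink , inner ]′
  (λ { (sink b) → inj₁ b , refl ; (inner u) → inj₂ u , refl })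
  (search-⊎ search-Bool any?)

search-Inner : ∀ n k → Searchable (Inner n k)
search-Inner n k = search-image (λ (v , l , h) → mkInner v l h)
  (λ { (mkInner v l h) → (v , l , h) , refl })
  (search-× (search-Var n) (search-× (search-Node k) (search-Node k)))

infix 4 _≟ᴺ_

_≟ᴺ_ : ∀ {k} (s t : Node k) → Dec (s ≡ t)
sink a  ≟ᴺ sink b  = map′ (cong sink) (λ { refl → refl }) (a Bool.≟ b)
inner u ≟ᴺ inner v = map′ (cong inner) (λ { refl → refl }) (u Fin.≟ v)
sink _  ≟ᴺ inner _ = no λ ()
inner _ ≟ᴺ sink _  = no λ ()

position< : ∀ {n} (v : Var n) → position v < 2 * n
position< {n} v = ≤-trans (s≤s (bound v)) (≤-trans (≤-reflexive (sym (*-suc 2 _))) (*-monoʳ-≤ 2 (toℕ<n (opposite (index v)))))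
  where
  index : Var n → Fin n
  index (𝕩 i) = i
  index (𝕪 i) = i
  bound : ∀ v → position v ≤ suc (2 * toℕ (opposite (index v)))
  bound (𝕩 i) = n≤1+n _
  bound (𝕪 i) = ≤-reflexive (+-comm (2 * toℕ (opposite i)) 1)

Ordered : ∀ {n k} → Vec (Inner n k) k → Set
Ordered {n} {k} inners =
  ∀ u v → (lo (lookup inners u) ≡ inner v → Interleaved n (var (lookup inners u)) (var (lookup inners v)))
        × (hi (lookup inners u) ≡ inner v → Interleaved n (var (lookup inners u)) (var (lookup inners v)))

ordered? : ∀ {n k} (inners : Vec (Inner n k) k) → Dec (Ordered inners)
ordered? inners = all? λ u → all? λ v →
  ((_ ≟ᴺ _) →-dec (_ <? _)) ×-dec ((_ ≟ᴺ _) →-dec (_ <? _))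

obdd : ∀ {n k} → Node k → (inners : Vec (Inner n k) k) → Ordered inners → OBDD (Interleaved n)
obdd root inners ordered = record
  { root = root ; inners = inners
  ; lo-ordered = λ u v → proj₁ (ordered u v) ; hi-ordered = λ u v → proj₂ (ordered u v) }

module _ {n : ℕ} (B : OBDD (Interleaved n)) (α : Var n → Bool) where
  open OBDD B

  reaches-unique : ∀ {s b c} → Reaches α s b → Reaches α s c → b ≡ c
  reaches-unique done     done     = refl
  reaches-unique (step r) (step s) = reaches-unique r s

  -- Positions increase along edges and stay below `2 * n`, so the distance from the current
  -- position to `2 * n` bounds the remaining steps; `fuel` is at least this distance.
  reaches-some : ∀ s → ∃[ b ] Reaches α s b
  reaches-some (sink b)  = b , done
  reaches-some (inner u) = go (2 * n) u (m≤n+m (2 * n) (position (var (at u))))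
    where
    successor : Fin k → Node k
    successor u = if α (var (at u)) then hi (at u) else lo (at u)
    successor-ordered : ∀ u v → successor u ≡ inner v → position (var (at u)) < position (var (at v))
    successor-ordered u v with α (var (at u))
    ... | true  = hi-ordered u v
    ... | false = lo-ordered u v
    go : ∀ fuel u → 2 * n ≤ position (var (at u)) + fuel → ∃[ b ] Reaches α (inner u) b
    go zero u enough = contradiction
      (subst (2 * n ≤_) (+-identityʳ _) enough) (<⇒≱ (position< (var (at u))))
    go (suc fuel) u enough with successor u in eq
    ... | sink b  = b , step (subst (λ s → Reaches α s b) (sym eq) done)
    ... | inner v =
      let b , r = go fuel v (≤-trans enough (≤-trans (≤-reflexive (+-suc _ fuel))
                    (+-monoˡ-≤ fuel (successor-ordered u v eq))))
      in b , step (subst (λ s → Reaches α s b) (sym eq) r)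

  reaches? : ∀ s b → Dec (Reaches α s b)
  reaches? s b = let c , r = reaches-some s in
    map′ (λ { refl → r }) (reaches-unique r) (c Bool.≟ b)

represents? : ∀ {n} (B : OBDD (Interleaved n)) f → Dec (Represents B f)
represents? {n} B f = search-∀ search-bits λ x → search-∀ search-bits λ y →
  reaches? B (assignment x y) _ (f x y)
  where
  search-bits : Searchable (Vec Bool n)
  search-bits = search-Vec search-Bool n

-- The raw data come first because they range over a finite type; whether they form a diagram for
-- `f` is then decided candidate by candidate.
Representable : ∀ {n} → (Vec Bool n → Vec Bool n → Bool) → ℕ → Set
Representable {n} f k = ∃ λ ((root , inners) : Node k × Vec (Inner n k) k) →
  Σ[ ordered ∈ Ordered inners ] Represents (obdd root inners ordered) f

representable : ∀ {n} {f : Vec Bool n → Vec Bool n → Bool} (B : OBDD (Interleaved n)) →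
                Represents B f → Representable f (OBDD.k B)
representable B r = (root , inners) , (λ u v → lo-ordered u v , hi-ordered u v) , r
  where open OBDD B

representable? : ∀ {n} (f : Vec Bool n → Vec Bool n → Bool) k → Dec (Representable f k)
representable? {n} f k =
  search-× (search-Node k) (search-Vec (search-Inner n k) k) decide
  where
  decide : ∀ ((root , inners) : Node k × Vec (Inner n k) k) →
           Dec (Σ[ ordered ∈ Ordered inners ] Represents (obdd root inners ordered) f)
  decide (root , inners) with ordered? inners
  ... | no ¬ordered = no (¬ordered ∘ proj₁)
  ... | yes ordered with represents? (obdd root inners ordered) f
  ...   | yes r = yes (ordered , r)
  -- `¬r` refutes the diagram built with one particular proof of `Ordered`; paths do not depend on
  -- that proof, so every other one is refuted too.
  ...   | no ¬r = no λ (ordered′ , r) → ¬r λ x y → transfer ordered′ (r x y)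
    where
    transfer : ∀ ordered′ {α s b} → OBDD.Reaches (obdd root inners ordered′) α s b →
               OBDD.Reaches (obdd root inners ordered) α s b
    transfer _        OBDD.done     = OBDD.done
    transfer ordered′ (OBDD.step r) = OBDD.step (transfer ordered′ r)

least : ∀ {P : ℕ → Set} → Decidable P → ∀ {k} → P k →
        ∃[ m ] P m × m ≤ k × (∀ {j} → P j → m ≤ j)
least P? {zero}  p = 0 , p , z≤n , λ _ → z≤n
least {P} P? {suc k} p with P? zero
... | yes p₀ = 0 , p₀ , z≤n , λ _ → z≤n
... | no ¬p₀ =
  let m , pm , m≤k , min = least {P ∘ suc} (P? ∘ suc) p
  in suc m , pm , s≤s m≤k , minimum min
  where
  minimum : ∀ {m} → (∀ {j} → P (suc j) → m ≤ j) → ∀ {j} → P j → suc m ≤ j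
  minimum min {zero}  p₀ = contradiction p₀ ¬p₀
  minimum min {suc j} pj = s≤s (min pj)

-- The given diagram bounds the search for the least number of inner nodes, and size differs from
-- that number by the two sinks.
minimal-obdd : ∀ {n} {f : Vec Bool n → Vec Bool n → Bool} (B : OBDD (Interleaved n)) →
               Represents B f → Σ[ M ∈ OBDD (Interleaved n) ] IsMinimal M f × size M ≤ size B
minimal-obdd {f = f} B r =
  let m , (_ , ordered , rm) , m≤k , min = least (representable? f) (representable B r)
  in obdd _ _ ordered
     , (rm , λ B′ r′ → +-monoˡ-≤ 2 (min (representable B′ r′)))
     , +-monoˡ-≤ 2 m≤k

-- Blocks of a staircase

-- The region `y ≤ r x` for a monotone `r`, described by its closure property so that `r` need not
-- be constructed.
Staircase : (ℕ → ℕ → Bool) → Set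
Staircase Q = ∀ {x x′ y y′} → x ≤ x′ → y′ ≤ y → Q x y ≡ true → Q x′ y′ ≡ true

Agree : ℕ → ℕ → (P Q : ℕ → ℕ → Bool) → Set
Agree a b P Q = ∀ {x y} → x < a → y < b → P x y ≡ Q x y

staircase-false : ∀ {Q} → Staircase Q → ∀ {x x′ y y′} → x ≤ x′ → y′ ≤ y →
                  Q x′ y′ ≡ false → Q x y ≡ false
staircase-false stair x≤x′ y′≤y q =
  Bool.¬-not λ p → case trans (sym (stair x≤x′ y′≤y p)) q of λ ()

-- The boundary of a staircase as a lattice path, one binary digit per step.
path : ℕ → ℕ → (ℕ → ℕ → Bool) → ℕ
path zero    _       Q = 0
path (suc a) zero    Q = 0
path (suc a) (suc b) Q =
  if Q 0 0 then suc (2 * path (suc a) b (λ x y → Q x (suc y)))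
           else 2 * path a (suc b) (λ x y → Q (suc x) y)

-- Each step of the path uses up one unit of `a + b` and writes one binary digit.
path< : ∀ a b Q → path a b Q < 2 ^ (a + b)
path< zero    b       Q = m^n>0 2 b
path< (suc a) zero    Q = m^n>0 2 (suc a + 0)
path< (suc a) (suc b) Q with Q 0 0
... | true  = begin
  2 + 2 * c                 ≡⟨ *-suc 2 c ⟨
  2 * suc c                 ≤⟨ *-monoʳ-≤ 2 (path< (suc a) b _) ⟩
  2 * 2 ^ (suc a + b)       ≡⟨ cong (λ e → 2 * 2 ^ e) (+-suc a b) ⟨
  2 ^ (suc a + suc b)       ∎
  where
  open ≤-Reasoning
  c = path (suc a) b (λ x y → Q x (suc y))
... | false = *-monoʳ-< 2 (path< a (suc b) _)

-- The parity of the code reveals the corner `Q 0 0`. A true corner makes the whole line `y = 0`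
-- true, a false one makes the whole line `x = 0` false; halving the code removes that line.
path-agree : ∀ a b {P Q} → Staircase P → Staircase Q →
             path a b P ≡ path a b Q → Agree a b P Q
path-agree (suc a) (suc b) {P} {Q} stairP stairQ eq {x} {y} x<a y<b
  with P 0 0 in p | Q 0 0 in q
... | true | false = contradiction (sym eq)
  (even≢odd (path a (suc b) λ x y → Q (suc x) y) (path (suc a) b λ x y → P x (suc y)))
... | false | true = contradiction eq
  (even≢odd (path a (suc b) λ x y → P (suc x) y) (path (suc a) b λ x y → Q x (suc y)))
... | true | true with y
...   | zero   = trans (stairP z≤n z≤n p) (sym (stairQ z≤n z≤n q))
...   | suc y′ = path-agree (suc a) b
  (λ u v → stairP u (s≤s v)) (λ u v → stairQ u (s≤s v))
  (*-cancelˡ-≡ _ _ 2 (suc-injective eq)) x<a (s<s⁻¹ y<b)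
path-agree (suc a) (suc b) {P} {Q} stairP stairQ eq {x} {y} x<a y<b
  | false | false with x
...   | zero   = trans (staircase-false stairP z≤n z≤n p) (sym (staircase-false stairQ z≤n z≤n q))
...   | suc x′ = path-agree a (suc b)
  (λ u v → stairP (s≤s u) v) (λ u v → stairQ (s≤s u) v)
  (*-cancelˡ-≡ _ _ 2 eq) (s<s⁻¹ x<a) y<b

block : (ℕ → ℕ → Bool) → ℕ → ℕ → ℕ → ℕ → ℕ → Bool
block F m i j x y = F (i * m + x) (j * m + y)

block-staircase : ∀ {Q} → Staircase Q → ∀ m i j → Staircase (block Q m i j)
block-staircase stair m i j x≤x′ y′≤y = stair (+-monoʳ-≤ (i * m) x≤x′) (+-monoʳ-≤ (j * m) y′≤y)

-- The interface between counting and diagrams: blocks of one class may share a node, so `κ` bounds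
-- the number of nodes needed to distinguish the blocks of side `m`.
record Classification (F : ℕ → ℕ → Bool) (m R κ : ℕ) : Set where
  field
    class   : Fin R → Fin R → Fin κ
    correct : ∀ {i j i′ j′} → class i j ≡ class i′ j′ →
              Agree m m (block F m (toℕ i) (toℕ j)) (block F m (toℕ i′) (toℕ j′))

by-path : ∀ {Q} → Staircase Q → ∀ m R → Classification Q m R (2 ^ (m + m))
by-path {Q} stair m R = record
  { class   = λ i j → fromℕ< (path< m m (block Q m (toℕ i) (toℕ j)))
  ; correct = λ {i} {j} {i′} {j′} eq → path-agree m m
      (block-staircase stair m (toℕ i) (toℕ j)) (block-staircase stair m (toℕ i′) (toℕ j′))
      (fromℕ<-injective _ _ _ _ eq)
  }

-- In base `m` the leading digit decides the comparison.
cell<cell : ∀ {m i i′ x x′} → i < i′ → x < m → i * m + x < i′ * m + x′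
cell<cell {m} {i} {i′} {x} {x′} i<i′ x<m = begin-strict
  i * m + x     <⟨ +-monoʳ-< (i * m) x<m ⟩
  i * m + m     ≡⟨ +-comm (i * m) m ⟩
  suc i * m     ≤⟨ *-monoˡ-≤ m i<i′ ⟩
  i′ * m        ≤⟨ m≤m+n (i′ * m) x′ ⟩
  i′ * m + x′   ∎
  where open ≤-Reasoning

-- The lower right and upper left corner decide whether a block is constant.
-- Of the blocks (i , j) with i + j fixed at most one is not constant, since
-- of any two of them one lies below and to the right of the other.
module _ {Q : ℕ → ℕ → Bool} (stair : Staircase Q) (m : ℕ) .{{_ : NonZero m}} where

  private
    B : ℕ → ℕ → ℕ → ℕ → Bool
    B = block Q m

    corner : pred m < m
    corner = ≤-reflexive (suc-pred m)

  -- Code 0 stands for all false, 1 for all true, larger codes for mixed blocks: the corner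
  -- `(pred m , 0)` is true as soon as any entry is, and `(0 , pred m)` only if all entries are.
  antidiagonal : ℕ → ℕ → ℕ
  antidiagonal i j =
    if B i j (pred m) 0 then (if B i j 0 (pred m) then 1 else 2 + (i + j)) else 0

  antidiagonal< : ∀ {i j R} → i < R → j < R → antidiagonal i j < 2 + (R + R)
  antidiagonal< {i} {j} i<R j<R with B i j (pred m) 0 | B i j 0 (pred m)
  ... | true  | true  = s≤s (s≤s z≤n)
  ... | true  | false = s≤s (s≤s (+-mono-< i<R j<R))
  ... | false | _     = s≤s z≤n

  private
    constant-false : ∀ i j {x y} → B i j (pred m) 0 ≡ false → x < m → B i j x y ≡ false
    constant-false i j p x<m =
      staircase-false (block-staircase stair m i j) (<⇒≤pred x<m) z≤n p

    constant-true : ∀ i j {x y} → B i j 0 (pred m) ≡ true → y < m → B i j x y ≡ true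
    constant-true i j p y<m = block-staircase stair m i j z≤n (<⇒≤pred y<m) p

    -- From `i < i′` on one antidiagonal follows `j′ < j`. Then every entry of the second block has
    -- larger `x` and smaller `y` than every entry of the first, and a single true entry of the
    -- first makes the second all true.
    mixed≮ : ∀ {i j i′ j′} → i + j ≡ i′ + j′ → B i j (pred m) 0 ≡ true →
             B i′ j′ 0 (pred m) ≡ false → ¬ i < i′
    mixed≮ {i} {j} {i′} {j′} eq p q i<i′ =
      case trans (sym (stair (<⇒≤ (cell<cell i<i′ corner)) (<⇒≤ (cell<cell j′<j corner)) p)) q of λ ()
      where
      j′<j : j′ < j
      j′<j = ≰⇒> λ j≤j′ → <⇒≢ (+-mono-<-≤ i<i′ j≤j′) eq

    mixed-unique : ∀ {i j i′ j′} → i + j ≡ i′ + j′ →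
                   B i j (pred m) 0 ≡ true → B i j 0 (pred m) ≡ false →
                   B i′ j′ (pred m) 0 ≡ true → B i′ j′ 0 (pred m) ≡ false →
                   i ≡ i′ × j ≡ j′
    mixed-unique {i} {j} {i′} {j′} eq p q p′ q′ with
      ≤-antisym {i} {i′} (≮⇒≥ (mixed≮ {i′} {j′} {i} {j} (sym eq) p′ q))
                         (≮⇒≥ (mixed≮ {i} {j} {i′} {j′} eq p q′))
    ... | refl = refl , +-cancelˡ-≡ i j j′ eq

  antidiagonal-agree : ∀ i j i′ j′ → antidiagonal i j ≡ antidiagonal i′ j′ →
                       Agree m m (B i j) (B i′ j′)
  antidiagonal-agree i j i′ j′ eq {x} {y} x<m y<m
    with B i j (pred m) 0 in p | B i j 0 (pred m) in q
       | B i′ j′ (pred m) 0 in p′ | B i′ j′ 0 (pred m) in q′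
  ... | false | _ | false | _ = trans (constant-false i j p x<m) (sym (constant-false i′ j′ p′ x<m))
  ... | true | true | true | true = trans (constant-true i j q y<m) (sym (constant-true i′ j′ q′ y<m))
  ... | true | false | true | false =
    let i≡i′ , j≡j′ = mixed-unique {i} {j} {i′} {j′} (suc-injective (suc-injective eq)) p q p′ q′
    in cong₂ (λ i j → B i j x y) i≡i′ j≡j′
  ... | false | _ | true | true = case eq of λ ()
  ... | false | _ | true | false = case eq of λ ()
  ... | true | true | false | _ = case eq of λ ()
  ... | true | false | false | _ = case eq of λ ()
  ... | true | true | true | false = case eq of λ ()
  ... | true | false | true | true = case eq of λ ()

  by-antidiagonal : ∀ R → Classification Q m R (2 + (R + R))
  by-antidiagonal R = record
    { class   = λ i j → fromℕ< (antidiagonal< (toℕ<n i) (toℕ<n j))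
    ; correct = λ {i} {j} {i′} {j′} eq →
        antidiagonal-agree (toℕ i) (toℕ j) (toℕ i′) (toℕ j′) (fromℕ<-injective _ _ _ _ eq)
    }

-- Symmetrised staircases

symmetrise : (ℕ → ℕ → Bool) → ℕ → ℕ → Bool
symmetrise Q x y with <-cmp x y
... | tri< _ _ _ = Q x y
... | tri≈ _ _ _ = false
... | tri> _ _ _ = Q y x

symmetrise-< : ∀ Q {x y} → x < y → symmetrise Q x y ≡ Q x y
symmetrise-< Q {x} {y} x<y with <-cmp x y
... | tri< _ _ _   = refl
... | tri≈ x≮y _ _ = contradiction x<y x≮y
... | tri> x≮y _ _ = contradiction x<y x≮y

symmetrise-≡ : ∀ Q x → symmetrise Q x x ≡ false
symmetrise-≡ Q x with <-cmp x x
... | tri< _ x≢x _ = contradiction refl x≢x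
... | tri≈ _ _ _   = refl
... | tri> _ x≢x _ = contradiction refl x≢x

symmetrise-> : ∀ Q {x y} → y < x → symmetrise Q x y ≡ Q y x
symmetrise-> Q {x} {y} y<x with <-cmp x y
... | tri< _ _ y≮x = contradiction y<x y≮x
... | tri≈ _ _ y≮x = contradiction y<x y≮x
... | tri> _ _ _   = refl

-- A block above the diagonal is a block of `Q`, one below is a transposed block of `Q`, and one on
-- the diagonal is determined by the block of `Q` there. Recording which case holds costs the factor
-- 3.
symmetrise-classification : ∀ {Q m R κ} → Classification Q m R κ →
                            Classification (symmetrise Q) m R (3 * κ)
symmetrise-classification {Q} {m} {R} {κ} C = record
  { class = cls ; correct = λ {i} {j} {i′} {j′} → cls-agree i j i′ j′ }
  where
  open Classification C

  above diagonal below : Fin 3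
  above    = zero
  diagonal = suc zero
  below    = suc (suc zero)

  cls : Fin R → Fin R → Fin (3 * κ)
  cls i j with <-cmp (toℕ i) (toℕ j)
  ... | tri< _ _ _ = combine above (class i j)
  ... | tri≈ _ _ _ = combine diagonal (class i i)
  -- The indices are swapped because this block is the transpose of block `(j , i)` of `Q`.
  ... | tri> _ _ _ = combine below (class j i)

  -- On the diagonal the offsets `x` and `y` inside the block alone decide between `Q`, its
  -- transpose and false, so the choice is the same for `i` and `i′`.
  diagonal-agree : ∀ i i′ → class i i ≡ class i′ i′ →
    Agree m m (block (symmetrise Q) m (toℕ i) (toℕ i)) (block (symmetrise Q) m (toℕ i′) (toℕ i′))
  diagonal-agree i i′ eq {x} {y} x<m y<m with <-cmp x y
  ... | tri< x<y _ _ = trans (symmetrise-< Q (+-monoʳ-< (toℕ i * m) x<y))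
                         (trans (correct eq x<m y<m) (sym (symmetrise-< Q (+-monoʳ-< (toℕ i′ * m) x<y))))
  ... | tri≈ _ refl _ = trans (symmetrise-≡ Q (toℕ i * m + x)) (sym (symmetrise-≡ Q (toℕ i′ * m + x)))
  ... | tri> _ _ y<x = trans (symmetrise-> Q (+-monoʳ-< (toℕ i * m) y<x))
                         (trans (correct eq y<m x<m) (sym (symmetrise-> Q (+-monoʳ-< (toℕ i′ * m) y<x))))

  cls-agree : ∀ i j i′ j′ → cls i j ≡ cls i′ j′ →
    Agree m m (block (symmetrise Q) m (toℕ i) (toℕ j)) (block (symmetrise Q) m (toℕ i′) (toℕ j′))
  cls-agree i j i′ j′ eq {x} {y} x<m y<m
    with <-cmp (toℕ i) (toℕ j) | <-cmp (toℕ i′) (toℕ j′)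
  ... | tri< i<j _ _ | tri< i′<j′ _ _ =
    trans (symmetrise-< Q (cell<cell i<j x<m))
      (trans (correct (proj₂ (combine-injective above (class i j) above (class i′ j′) eq)) x<m y<m)
        (sym (symmetrise-< Q (cell<cell i′<j′ x<m))))
  ... | tri> _ _ j<i | tri> _ _ j′<i′ =
    trans (symmetrise-> Q (cell<cell j<i y<m))
      (trans (correct (proj₂ (combine-injective below (class j i) below (class j′ i′) eq)) y<m x<m)
        (sym (symmetrise-> Q (cell<cell j′<i′ y<m))))
  ... | tri≈ _ i≡j _ | tri≈ _ i′≡j′ _ = subst₂
    (λ j j′ → block (symmetrise Q) m (toℕ i) j x y ≡ block (symmetrise Q) m (toℕ i′) j′ x y) i≡j i′≡j′
    (diagonal-agree i i′ (proj₂ (combine-injective diagonal (class i i) diagonal (class i′ i′) eq)) x<m y<m)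
  ... | tri< _ _ _ | tri≈ _ _ _ = case proj₁ (combine-injective above (class i j) diagonal (class i′ i′) eq) of λ ()
  ... | tri< _ _ _ | tri> _ _ _ = case proj₁ (combine-injective above (class i j) below (class j′ i′) eq) of λ ()
  ... | tri≈ _ _ _ | tri< _ _ _ = case proj₁ (combine-injective diagonal (class i i) above (class i′ j′) eq) of λ ()
  ... | tri≈ _ _ _ | tri> _ _ _ = case proj₁ (combine-injective diagonal (class i i) below (class j′ i′) eq) of λ ()
  ... | tri> _ _ _ | tri< _ _ _ = case proj₁ (combine-injective below (class j i) above (class i′ j′) eq) of λ ()
  ... | tri> _ _ _ | tri≈ _ _ _ = case proj₁ (combine-injective below (class j i) diagonal (class i′ i′) eq) of λ ()

-- OBDDs from classified blocks

representative : ∀ {A : Set} {k} → Searchable A → A → (f : A → Fin k) →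
                 Σ[ g ∈ (Fin k → A) ] ∀ a → f (g (f a)) ≡ f a
representative {A} {k} search a₀ f = g , correct
  where
  g : Fin k → A
  g c with search (λ a → f a Fin.≟ c)
  ... | yes (a , _) = a
  -- An empty class receives a default; no class of the form `f a` is empty.
  ... | no _        = a₀
  correct : ∀ a → f (g (f a)) ≡ f a
  correct a with search (λ a′ → f a′ Fin.≟ f a)
  ... | yes (_ , eq) = eq
  ... | no ¬∃        = contradiction (a , refl) ¬∃

∑< : ℕ → (ℕ → ℕ) → ℕ
∑< zero    f = 0
∑< (suc n) f = f 0 + ∑< n (f ∘ suc)

-- The layers of a diagram have different sizes; placing them one after another numbers all nodes by
-- a single `Fin`.
Σ-encode : ∀ {n} (s : ℕ → ℕ) (e : Fin n) → Fin (s (toℕ e)) → Fin (∑< n s)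
Σ-encode {suc n} s zero    c = c ↑ˡ ∑< n (s ∘ suc)
Σ-encode {suc n} s (suc e) c = s 0 ↑ʳ Σ-encode (s ∘ suc) e c

Σ-decode : ∀ n (s : ℕ → ℕ) → Fin (∑< n s) → Σ[ e ∈ Fin n ] Fin (s (toℕ e))
Σ-decode (suc n) s u with splitAt (s 0) u
... | inj₁ c = zero , c
... | inj₂ v = let e , c = Σ-decode n (s ∘ suc) v in suc e , c

Σ-decode-encode : ∀ {n} (s : ℕ → ℕ) (e : Fin n) c → Σ-decode n s (Σ-encode s e c) ≡ (e , c)
Σ-decode-encode {suc n} s zero    c rewrite splitAt-↑ˡ (s 0) c (∑< n (s ∘ suc)) = refl
Σ-decode-encode {suc n} s (suc e) c
  rewrite splitAt-↑ʳ (s 0) (∑< n (s ∘ suc)) (Σ-encode (s ∘ suc) e c)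
        | Σ-decode-encode (s ∘ suc) e c = refl

-- This is `∣ x ∣` modulo `2 ^ d`, the part of `x` still unread when `d` bits remain.
low : ∀ {n} → ℕ → Vec Bool n → ℕ
low zero    _       = 0
low (suc d) []      = 0
low (suc d) (b ∷ x) = bit b + 2 * low d x

low< : ∀ {n} d (x : Vec Bool n) → low d x < 2 ^ d
low< zero    x       = s≤s z≤n
low< (suc d) []      = m^n>0 2 (suc d)
low< (suc d) (b ∷ x) = begin-strict
  bit b + 2 * low d x   ≤⟨ +-monoˡ-≤ (2 * low d x) (bit≤1 b) ⟩
  1 + 2 * low d x       <⟨ n<1+n _ ⟩
  2 + 2 * low d x       ≡⟨ *-suc 2 (low d x) ⟨
  2 * suc (low d x)     ≤⟨ *-monoʳ-≤ 2 (low< d x) ⟩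
  2 * 2 ^ d             ∎
  where
  open ≤-Reasoning
  bit≤1 : ∀ b → bit b ≤ 1
  bit≤1 true  = s≤s z≤n
  bit≤1 false = z≤n

-- `low` recurses from the least significant bit, whereas the diagram reads the most significant one
-- first; this is the recursion from that end.
low-suc : ∀ {n} (e : Fin n) (x : Vec Bool n) →
          low (suc (toℕ e)) x ≡ bit (lookup x e) * 2 ^ toℕ e + low (toℕ e) x
low-suc zero (b ∷ x) = sym (cong (_+ 0) (*-identityʳ (bit b)))
low-suc (suc e) (b ∷ x) = trans (cong (λ l → bit b + 2 * l) (low-suc e x))
  (shuffle (bit b) (bit (lookup x e)) (2 ^ toℕ e) (low (toℕ e) x))
  where
  shuffle : ∀ b c p l → b + 2 * (c * p + l) ≡ c * (2 * p) + (b + 2 * l)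
  shuffle = solve-∀

low-all : ∀ {n} (x : Vec Bool n) → low n x ≡ ∣ x ∣
low-all [] = refl
low-all {suc n} (b ∷ x) = cong₂ _+_ (sym (*-identityʳ (bit b)))
  (trans (cong (2 *_) (low-all x)) (sum-double (λ i → shuffle (bit (lookup x i)) (2 ^ toℕ i))))
  where
  shuffle : ∀ c p → 2 * (c * p) ≡ c * (2 * p)
  shuffle = solve-∀
  sum-double : ∀ {n} {f g : Fin n → ℕ} → (∀ i → 2 * f i ≡ g i) →
               2 * sum (tabulate f) ≡ sum (tabulate g)
  sum-double {zero}          _  = refl
  sum-double {suc n} {f} {g} eq =
    trans (*-distribˡ-+ 2 (f zero) _) (cong₂ _+_ (eq zero) (sum-double (eq ∘ suc)))

digit : Bool → Fin 2
digit false = zero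
digit true  = suc zero

toℕ-digit : ∀ b → toℕ (digit b) ≡ bit b
toℕ-digit false = refl
toℕ-digit true  = refl

-- Once the bits above `e` are read, their values `i` and `j` select a block of side `2 ^ suc e`,
-- and the rest of the input selects an entry in it. Layer `e` has nodes for the classes of these
-- blocks.
module Layered
  (F : ℕ → ℕ → Bool) (n : ℕ) (κ : ℕ → ℕ)
  (C : ∀ (e : Fin n) → Classification F (2 ^ suc (toℕ e)) (2 ^ (n ∸ suc (toℕ e))) (κ (toℕ e)))
  where

  Index : ℕ → Set
  Index d = Fin (2 ^ (n ∸ d))

  origin : ∀ d → Index d
  origin d = fromℕ< (m^n>0 2 (n ∸ d))

  class : ∀ e → Index (suc (toℕ e)) × Index (suc (toℕ e)) → Fin (κ (toℕ e))
  class e (i , j) = Classification.class (C e) i j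

  private
    representatives : ∀ e → Σ[ g ∈ (Fin (κ (toℕ e)) → Index (suc (toℕ e)) × Index (suc (toℕ e))) ]
                            ∀ ij → class e (g (class e ij)) ≡ class e ij
    representatives e = representative (search-× any? any?) (origin (suc (toℕ e)) , origin (suc (toℕ e))) (class e)

  rep : ∀ e → Fin (κ (toℕ e)) → Index (suc (toℕ e)) × Index (suc (toℕ e))
  rep e = proj₁ (representatives e)

  -- Reading one more bit halves the side of the block and appends a binary digit to its index.
  child : ∀ e → Index (suc (toℕ e)) → Fin 2 → Index (toℕ (inject₁ e))
  child e i b = cast (trans (*-comm (2 ^ (n ∸ suc (toℕ e))) 2) (cong (2 ^_) halve)) (combine i b)
    where
    halve : suc (n ∸ suc (toℕ e)) ≡ n ∸ toℕ (inject₁ e)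
    halve = trans (sym (+-∸-assoc 1 (toℕ<n e))) (cong (n ∸_) (sym (toℕ-inject₁ e)))

  toℕ-child : ∀ e i b → toℕ (child e i b) ≡ 2 * toℕ i + toℕ b
  toℕ-child e i b = trans (toℕ-cast _ (combine i b)) (toℕ-combine i b)

  -- In Fin 3, 0 marks the node that reads bit e of x, and 1 + b the node that
  -- reads bit e of y after bit b of x.
  Address : Set
  Address = Σ[ e ∈ Fin n ] Fin 3 × Fin (κ (toℕ e))

  count : ℕ
  count = ∑< n (λ d → 3 * κ d)

  encode : Address → Fin count
  encode (e , t , c) = Σ-encode (λ d → 3 * κ d) e (combine t c)

  decode : Fin count → Address
  decode u = let e , c = Σ-decode n (λ d → 3 * κ d) u in e , remQuot (κ (toℕ e)) c

  decode-encode : ∀ a → decode (encode a) ≡ a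
  decode-encode (e , t , c)
    rewrite Σ-decode-encode (λ d → 3 * κ d) e (combine t c) = cong (e ,_) (remQuot-combine t c)

  -- The entry point for a block of side `2 ^ d`. It depends on the block only through its class,
  -- which is where nodes are shared; a block of side 1 is a single value.
  next : ∀ (d : Fin (suc n)) → Index (toℕ d) → Index (toℕ d) → Node count
  next zero    i j = sink (F (toℕ i) (toℕ j))
  next (suc e) i j = inner (encode (e , zero , class e (i , j)))

  content : Address → Inner n count
  content (e , zero , c) =
    mkInner (𝕩 e) (inner (encode (e , suc zero , c))) (inner (encode (e , suc (suc zero) , c)))
  -- A node knows only the class of its block, so its successors are the quarters of the chosen
  -- representative.
  content (e , suc b , c) = let i , j = rep e c in
    mkInner (𝕪 e) (next (inject₁ e) (child e i b) (child e j zero))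
                  (next (inject₁ e) (child e i b) (child e j (suc zero)))

  inners : Vec (Inner n count) count
  inners = tabulate (content ∘ decode)

  lookup-encode : ∀ a → lookup inners (encode a) ≡ content a
  lookup-encode a = trans (lookup∘tabulate (content ∘ decode) (encode a)) (cong content (decode-encode a))

  𝕩<𝕪 : ∀ (e : Fin n) → Interleaved n (𝕩 e) (𝕪 e)
  𝕩<𝕪 e = m<m+n _ (s≤s z≤n)

  𝕪<𝕩 : ∀ (e e′ : Fin n) → inject₁ e ≡ suc e′ → Interleaved n (𝕪 e) (𝕩 e′)
  𝕪<𝕩 e e′ eq rewrite opposite-prop e | opposite-prop e′ = begin-strict
    2 * (n ∸ suc (toℕ e)) + 1     <⟨ +-monoʳ-< (2 * (n ∸ suc (toℕ e))) (n<1+n 1) ⟩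
    2 * (n ∸ suc (toℕ e)) + 2     ≡⟨ +-comm _ 2 ⟩
    2 + 2 * (n ∸ suc (toℕ e))     ≡⟨ *-suc 2 _ ⟨
    2 * suc (n ∸ suc (toℕ e))     ≡⟨ cong (2 *_) (+-∸-assoc 1 (toℕ<n e)) ⟨
    2 * (n ∸ toℕ e)               ≡⟨ cong (λ d → 2 * (n ∸ d)) (trans (sym (toℕ-inject₁ e)) (cong toℕ eq)) ⟩
    2 * (n ∸ suc (toℕ e′))        ∎
    where open ≤-Reasoning

  before : Var n → Node count → Set
  before v s = ∀ {u} → s ≡ inner u → Interleaved n v (var (lookup inners u))

  before-encode : ∀ v a → Interleaved n v (var (content a)) → before v (inner (encode a))
  before-encode v a v<a refl = subst (λ I → Interleaved n v (var I)) (sym (lookup-encode a)) v<a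

  -- `next` computes only on `zero` and `suc`, so `inject₁ e` is generalised to a variable `d` with
  -- an equation.
  before-next : ∀ e d i j → inject₁ e ≡ d → before (𝕪 e) (next d i j)
  before-next e zero     i j _  ()
  before-next e (suc e′) i j eq =
    before-encode (𝕪 e) (e′ , zero , class e′ (i , j)) (𝕪<𝕩 e e′ eq)

  before-lo : ∀ a → before (var (content a)) (lo (content a))
  before-lo (e , zero  , c) = before-encode (𝕩 e) (e , suc zero , c) (𝕩<𝕪 e)
  before-lo (e , suc b , c) = let i , j = rep e c in
    before-next e (inject₁ e) (child e i b) (child e j zero) refl

  before-hi : ∀ a → before (var (content a)) (hi (content a))
  before-hi (e , zero  , c) = before-encode (𝕩 e) (e , suc (suc zero) , c) (𝕩<𝕪 e)
  before-hi (e , suc b , c) = let i , j = rep e c in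
    before-next e (inject₁ e) (child e i b) (child e j (suc zero)) refl

  ordered : Ordered inners
  ordered u v = subst (λ I → (lo I ≡ inner v → Interleaved n (var I) (var (lookup inners v)))
                           × (hi I ≡ inner v → Interleaved n (var I) (var (lookup inners v))))
    (sym (lookup∘tabulate (content ∘ decode) u)) (before-lo (decode u) , before-hi (decode u))

  layered : OBDD (Interleaved n)
  -- Before any bit is read there is one block, of side `2 ^ n` and index 0.
  layered = obdd (next (fromℕ n) (origin (toℕ (fromℕ n))) (origin (toℕ (fromℕ n)))) inners ordered

  open OBDD layered using (Reaches; step; done)

  module _ (x y : Vec Bool n) where

    step-encode : ∀ a {b} →
      Reaches (assignment x y)
        (if assignment x y (var (content a)) then hi (content a) else lo (content a)) b →
      Reaches (assignment x y) (inner (encode a)) b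
    step-encode a {b} r = step (subst
      (λ I → Reaches (assignment x y) (if assignment x y (var I) then hi I else lo I) b)
      (sym (lookup-encode a)) r)

    -- The invariant of evaluation: leading bits are held in `i` and `j`, the others are still taken
    -- from `x` and `y`. Reading a bit moves it from the second group to the first.
    value : ∀ (d : Fin (suc n)) → Index (toℕ d) → Index (toℕ d) → Bool
    value d i j = F (toℕ i * 2 ^ toℕ d + low (toℕ d) x) (toℕ j * 2 ^ toℕ d + low (toℕ d) y)

    position-child : ∀ e i (z : Vec Bool n) →
      toℕ (child e i (digit (lookup z e))) * 2 ^ toℕ (inject₁ e) + low (toℕ (inject₁ e)) z
        ≡ toℕ i * 2 ^ suc (toℕ e) + low (suc (toℕ e)) z
    position-child e i z
      rewrite toℕ-child e i (digit (lookup z e)) | toℕ-inject₁ e | low-suc e z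
            | toℕ-digit (lookup z e) =
      shuffle (toℕ i) (bit (lookup z e)) (2 ^ toℕ e) (low (toℕ e) z)
      where
      shuffle : ∀ i b p l → (2 * i + b) * p + l ≡ i * (2 * p) + (b * p + l)
      shuffle = solve-∀

    value-child : ∀ e i j →
      value (inject₁ e) (child e i (digit (lookup x e))) (child e j (digit (lookup y e)))
        ≡ value (suc e) i j
    value-child e i j = cong₂ F (position-child e i x) (position-child e j y)

    -- The unread bits are offsets smaller than the side of the block, so blocks of equal class give
    -- the same value there.
    value-rep : ∀ e i j → let i′ , j′ = rep e (class e (i , j)) in
                value (suc e) i′ j′ ≡ value (suc e) i j
    value-rep e i j = Classification.correct (C e) (proj₂ (representatives e) (i , j))
      (low< (suc (toℕ e)) x) (low< (suc (toℕ e)) y)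

    reaches : ∀ (d : Fin (suc n)) i j → Reaches (assignment x y) (next d i j) (value d i j)
    reaches = <-weakInduction
      (λ d → ∀ i j → Reaches (assignment x y) (next d i j) (value d i j)) at-sink at-node
      where
      at-sink : ∀ (i j : Index 0) → Reaches (assignment x y) (next zero i j) (value zero i j)
      at-sink i j = subst (Reaches (assignment x y) (next zero i j))
        (sym (cong₂ F (trivial (toℕ i)) (trivial (toℕ j)))) done
        where
        trivial : ∀ i → i * 1 + 0 ≡ i
        trivial = solve-∀

      at-node : ∀ e → (∀ i j → Reaches (assignment x y) (next (inject₁ e) i j) (value (inject₁ e) i j)) →
                ∀ i j → Reaches (assignment x y) (next (suc e) i j) (value (suc e) i j)
      at-node e ih i j =
        step-encode (e , zero , c) (read-x (lookup x e)
          (step-encode (e , suc (digit (lookup x e)) , c) (read-y (lookup y e)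
            -- The quarter of the representative has the value of the representative, which is the
            -- value of the original block.
            (subst (Reaches (assignment x y) _) (trans (value-child e i′ j′) (value-rep e i j))
              (ih (child e i′ (digit (lookup x e))) (child e j′ (digit (lookup y e))))))))
        where
        c = class e (i , j)
        i′ = proj₁ (rep e c)
        j′ = proj₂ (rep e c)
        read-x : ∀ b {v} → Reaches (assignment x y) (inner (encode (e , suc (digit b) , c))) v →
          Reaches (assignment x y) (if b then hi (content (e , zero , c)) else lo (content (e , zero , c))) v
        read-x false r = r
        read-x true  r = r
        read-y : ∀ b {t v} → Reaches (assignment x y) (next (inject₁ e) (child e i′ t) (child e j′ (digit b))) v →
          Reaches (assignment x y)
            (if b then hi (content (e , suc t , c)) else lo (content (e , suc t , c))) v
        read-y false r = r
        read-y true  r = r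

  layered-represents : Represents layered (λ x y → F ∣ x ∣ ∣ y ∣)
  layered-represents x y = subst (Reaches (assignment x y) _)
    (cong₂ F (whole x) (whole y)) (reaches x y (fromℕ n) (origin (toℕ (fromℕ n))) (origin (toℕ (fromℕ n))))
    where
    whole : (z : Vec Bool n) → toℕ (origin (toℕ (fromℕ n))) * 2 ^ toℕ (fromℕ n) + low (toℕ (fromℕ n)) z ≡ ∣ z ∣
    whole z rewrite toℕ-fromℕ< (m^n>0 2 (n ∸ toℕ (fromℕ n))) | toℕ-fromℕ n = low-all z

-- The size bound for unit interval graphs

-- Roundedness closes lower cuts downwards, and the lower cut of `x +1` at `q` is that of `x` at
-- `q - 1`.
x≤x+1 : ∀ x → x ≤ᵣ x +1
x≤x+1 x q Lq = Equivalence.from (ℝ.L-rounded x (q ℚ.- ℚ.1ℚ)) (q , q-1<q , Lq)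
  where
  q-1<q : q ℚ.- ℚ.1ℚ ℚ.< q
  q-1<q = subst (q ℚ.- ℚ.1ℚ ℚ.<_) (ℚ.+-identityʳ q) (ℚ.+-monoʳ-< q (ℚ.negative⁻¹ (ℚ.- ℚ.1ℚ)))

module _ {N : ℕ} (G : UnitIntervalGraph N) where
  open UnitIntervalGraph G

  ~-sym : ∀ {i j} → i ~ j → j ~ i
  ~-sym {i} {j} i~j = let i≢j , p , p∈i , p∈j = Equivalence.to (~⇔ i j) i~j in
    Equivalence.from (~⇔ j i) (i≢j ∘ sym , p , p∈j , p∈i)

  -- The point a j′ witnesses the intersection: a j′ ≤ a j ≤ a i + 1 ≤ a i′ + 1.
  ~-between : ∀ {i i′ j′ j} → toℕ i ≤ toℕ i′ → toℕ i′ < toℕ j′ → toℕ j′ ≤ toℕ j → i ~ j → i′ ~ j′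
  ~-between {i} {i′} {j′} {j} i≤i′ i′<j′ j′≤j i~j =
    let _ , p , (_ , p≤aᵢ+1) , (aⱼ≤p , _) = Equivalence.to (~⇔ i j) i~j
    in Equivalence.from (~⇔ i′ j′)
         ( (λ eq → <⇒≢ i′<j′ (cong toℕ eq))
         , a j′
         , ( sorted i′ j′ (<⇒≤ i′<j′)
           , λ q → sorted i i′ i≤i′ (q ℚ.- ℚ.1ℚ) ∘ p≤aᵢ+1 q ∘ aⱼ≤p q ∘ sorted j′ j j′≤j q)
         , ((λ _ l → l) , x≤x+1 (a j′)))

  -- `χ` as a function of the encoded numbers, to which the arguments on blocks apply.
  adjacent : ℕ → ℕ → Bool
  adjacent x y with x <? N | y <? N
  ... | yes x<N | yes y<N = does (fromℕ< x<N ~? fromℕ< y<N)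
  ... | _       | _       = false

  χ-adjacent : ∀ {n} (x y : Vec Bool n) → χ G x y ≡ adjacent ∣ x ∣ ∣ y ∣
  χ-adjacent x y with ∣ x ∣ <? N | ∣ y ∣ <? N
  ... | yes _ | yes _ = refl
  ... | yes _ | no _  = refl
  ... | no _  | yes _ = refl
  ... | no _  | no _  = refl

  adjacent⇒~ : ∀ {x y} → adjacent x y ≡ true → ∃[ i ] ∃[ j ] toℕ i ≡ x × toℕ j ≡ y × i ~ j
  adjacent⇒~ {x} {y} eq with x <? N | y <? N
  adjacent⇒~ eq | yes x<N | yes y<N with fromℕ< x<N ~? fromℕ< y<N
  ... | yes i~j = fromℕ< x<N , fromℕ< y<N , toℕ-fromℕ< x<N , toℕ-fromℕ< y<N , i~j
  adjacent⇒~ () | yes _ | yes _ | no _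
  adjacent⇒~ () | yes _ | no _
  adjacent⇒~ () | no _  | _

  ~⇒adjacent : ∀ {i j} → i ~ j → adjacent (toℕ i) (toℕ j) ≡ true
  ~⇒adjacent {i} {j} i~j with toℕ i <? N | toℕ j <? N
  ... | yes p | yes q rewrite fromℕ<-toℕ i p | fromℕ<-toℕ j q = dec-true (i ~? j) i~j
  ... | no ¬p | _     = contradiction (toℕ<n i) ¬p
  ... | yes _ | no ¬q = contradiction (toℕ<n j) ¬q

  adjacent-sym⇒ : ∀ {x y} → adjacent x y ≡ true → adjacent y x ≡ true
  adjacent-sym⇒ eq with adjacent⇒~ eq
  ... | i , j , refl , refl , i~j = ~⇒adjacent (~-sym i~j)

  adjacent-sym : ∀ x y → adjacent x y ≡ adjacent y x
  adjacent-sym x y = Bool.⇔→≡ {z = true} (mk⇔ adjacent-sym⇒ adjacent-sym⇒)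

  adjacent-irrefl : ∀ x → adjacent x x ≡ false
  adjacent-irrefl x = Bool.¬-not λ eq → let i , j , i≡x , j≡x , i~j = adjacent⇒~ eq in
    proj₁ (Equivalence.to (~⇔ i j) i~j) (toℕ-injective (trans i≡x (sym j≡x)))

  -- Adjacency forces `y < N`, and `x′ < y′ ≤ y` then makes `x′` and `y′` labels of nodes, so
  -- `~-between` applies.
  adjacent-between : ∀ {x x′ y′ y} → x ≤ x′ → x′ < y′ → y′ ≤ y →
                     adjacent x y ≡ true → adjacent x′ y′ ≡ true
  adjacent-between {x′ = x′} {y′ = y′} x≤x′ x′<y′ y′≤y eq with adjacent⇒~ eq
  ... | i , j , refl , refl , i~j =
    subst₂ (λ u v → adjacent u v ≡ true) (toℕ-fromℕ< x′<N) (toℕ-fromℕ< y′<N)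
      (~⇒adjacent (~-between
        (subst (toℕ i ≤_) (sym (toℕ-fromℕ< x′<N)) x≤x′)
        (subst₂ _<_ (sym (toℕ-fromℕ< x′<N)) (sym (toℕ-fromℕ< y′<N)) x′<y′)
        (subst (_≤ toℕ j) (sym (toℕ-fromℕ< y′<N)) y′≤y) i~j))
    where
    y′<N : y′ < N
    y′<N = ≤-<-trans y′≤y (toℕ<n j)
    x′<N : x′ < N
    x′<N = <-trans x′<y′ y′<N

  -- y ≤ r x, where v (r x) is the rightmost neighbour of v x, or v x itself.
  reach : ℕ → ℕ → Bool
  reach x y with y ≤? x
  ... | yes _ = true
  ... | no _  = adjacent x y

  -- Only the case `x′ < y′` is in question. There `x ≤ x′ < y′ ≤ y`, so the hypothesis is a genuine
  -- adjacency and passes to the nodes in between.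
  reach-staircase : Staircase reach
  reach-staircase {x} {x′} {y} {y′} x≤x′ y′≤y eq with y ≤? x | y′ ≤? x′
  ... | _       | yes _    = refl
  ... | yes y≤x | no y′≰x′ = contradiction (≤-trans y′≤y (≤-trans y≤x x≤x′)) y′≰x′
  ... | no _    | no y′≰x′ = adjacent-between x≤x′ (≰⇒> y′≰x′) y′≤y eq

  reach-< : ∀ {x y} → x < y → reach x y ≡ adjacent x y
  reach-< {x} {y} x<y with y ≤? x
  ... | yes y≤x = contradiction y≤x (<⇒≱ x<y)
  ... | no _    = refl

  -- On the diagonal `reach` is true, but `symmetrise` puts false there, in accordance with the
  -- absence of loops.
  symmetrise-reach : ∀ x y → symmetrise reach x y ≡ adjacent x y
  symmetrise-reach x y with <-cmp x y
  ... | tri< x<y _ _  = reach-< x<y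
  ... | tri≈ _ refl _ = sym (adjacent-irrefl x)
  ... | tri> _ _ y<x  = trans (reach-< y<x) (adjacent-sym y x)

-- Choice of the threshold and count of the nodes

κ : ℕ → ℕ → ℕ → ℕ
-- Layers below `D` have small blocks and are counted by boundary paths, the others by
-- antidiagonals.
κ n D d with d <? D
... | yes _ = 3 * 2 ^ (2 ^ suc d + 2 ^ suc d)
... | no _  = 3 * (2 + (2 ^ (n ∸ suc d) + 2 ^ (n ∸ suc d)))

staircase-classification : ∀ {Q} → Staircase Q → ∀ n D d →
  Classification (symmetrise Q) (2 ^ suc d) (2 ^ (n ∸ suc d)) (κ n D d)
staircase-classification stair n D d with d <? D
... | yes _ = symmetrise-classification (by-path stair (2 ^ suc d) (2 ^ (n ∸ suc d)))
... | no _  = symmetrise-classification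
                (by-antidiagonal stair (2 ^ suc d) {{m^n≢0 2 (suc d)}} (2 ^ (n ∸ suc d)))

∑<-+ : ∀ a b f → ∑< (a + b) f ≡ ∑< a f + ∑< b (f ∘ (a +_))
∑<-+ zero    b f = refl
∑<-+ (suc a) b f = trans (cong (f 0 +_) (∑<-+ a b (f ∘ suc))) (sym (+-assoc (f 0) _ _))

∑<-constant : ∀ a {f c} → (∀ {i} → i < a → f i ≤ c) → ∑< a f ≤ a * c
∑<-constant zero    f≤c = z≤n
∑<-constant (suc a) f≤c = +-mono-≤ (f≤c (s≤s z≤n)) (∑<-constant a (f≤c ∘ s≤s))

-- The bounds halve from term to term, so the first term and the sum of the rest are each at most
-- `c * 2 ^ (e - 1)`.
∑<-geometric : ∀ e {f c} → (∀ i → f i ≤ c * 2 ^ (e ∸ suc i)) → ∑< e f ≤ c * 2 ^ e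
∑<-geometric zero    f≤ = z≤n
∑<-geometric (suc e) {f} {c} f≤ = begin
  f 0 + ∑< e (f ∘ suc)      ≤⟨ +-mono-≤ (f≤ 0) (∑<-geometric e {c = c} (f≤ ∘ suc)) ⟩
  c * 2 ^ e + c * 2 ^ e     ≡⟨ double c (2 ^ e) ⟩
  c * 2 ^ suc e             ∎
  where
  open ≤-Reasoning
  double : ∀ c p → c * p + c * p ≡ c * (2 * p)
  double = solve-∀

n<2^n : ∀ n → n < 2 ^ n
n<2^n zero    = s≤s z≤n
n<2^n (suc n) = begin-strict
  1 + n           <⟨ +-mono-≤-< (m^n>0 2 n) (n<2^n n) ⟩
  2 ^ n + 2 ^ n   ≡⟨ cong (2 ^ n +_) (+-identityʳ (2 ^ n)) ⟨
  2 ^ suc n       ∎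
  where open ≤-Reasoning

-- The power `2 ^ D` is kept between `n / 8` and `n / 4` by raising `D` whenever `n` outgrows
-- `8 * 2 ^ D`. For small `n` the upper limit may fail, but then `D` is 0 and there are no low
-- layers.
threshold : ∀ n → ∃[ D ] n ≤ 8 * 2 ^ D × (D ≡ 0 ⊎ 4 * 2 ^ D ≤ n)
threshold zero = 0 , z≤n , inj₁ refl
threshold (suc n) with threshold n
... | D , n≤ , D-low with suc n ≤? 8 * 2 ^ D
...   | yes n< = D , n< , [ inj₁ , inj₂ ∘ m≤n⇒m≤1+n ]′ D-low
...   | no n≮  = suc D
  , ≤-trans (s≤s n≤) (≤-trans (+-monoˡ-≤ (8 * 2 ^ D) 1≤) (≤-reflexive (twice (2 ^ D))))
  , inj₂ (≤-trans (≤-reflexive (sym (eight (2 ^ D)))) (<⇒≤ (≰⇒> n≮)))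
  where
  twice : ∀ p → 8 * p + 8 * p ≡ 8 * (2 * p)
  twice = solve-∀
  eight : ∀ p → 8 * p ≡ 4 * (2 * p)
  eight = solve-∀
  1≤ : 1 ≤ 8 * 2 ^ D
  1≤ = ≤-trans (m^n>0 2 D) (m≤n*m (2 ^ D) 8)

-- Three nodes per class and three positions relative to the diagonal give 9; the side `2 ^ suc d`
-- is at most `2 ^ D`.
κ-low : ∀ n D {d} → d < D → 3 * κ n D d ≤ 9 * 2 ^ (2 ^ D + 2 ^ D)
κ-low n D {d} d<D with d <? D
... | yes _  = ≤-trans (≤-reflexive (sym (*-assoc 3 3 (2 ^ (2 ^ suc d + 2 ^ suc d)))))
  (*-monoʳ-≤ 9 (^-monoʳ-≤ 2 (+-mono-≤ (^-monoʳ-≤ 2 d<D) (^-monoʳ-≤ 2 d<D))))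
... | no d≮D = contradiction d<D d≮D

-- With `R ≥ 1` the `2 + 2R` codes are at most `4R`, and 36 is 9 times 4.
κ-high : ∀ D e i → 3 * κ (D + e) D (D + i) ≤ 36 * 2 ^ (e ∸ suc i)
κ-high D e i with D + i <? D
... | yes D+i<D = contradiction D+i<D (m+n≮m D i)
... | no _ rewrite sym (+-suc D i) | [m+n]∸[m+o]≡n∸o D e (suc i) = begin
  3 * (3 * (2 + (R + R)))       ≤⟨ *-monoʳ-≤ 3 (*-monoʳ-≤ 3 (+-monoˡ-≤ (R + R) (*-monoʳ-≤ 2 (m^n>0 2 (e ∸ suc i))))) ⟩
  3 * (3 * (2 * R + (R + R)))   ≡⟨ collect R ⟩
  36 * R                        ∎
  where
  open ≤-Reasoning
  R = 2 ^ (e ∸ suc i)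
  collect : ∀ R → 3 * (3 * (2 * R + (R + R))) ≡ 36 * R
  collect = solve-∀

-- With `t = 2 ^ D` the factors `D ≤ t` and `n ≤ 8 * t` contribute `8 * t * t`, and
-- `t * t ≤ 2 ^ (2 * t)`. The total exponent is then `4 * t ≤ n`.
low-layers : ∀ n D → n ≤ 8 * 2 ^ D → D ≡ 0 ⊎ 4 * 2 ^ D ≤ n →
             D * 2 ^ (2 ^ D + 2 ^ D) * n ≤ 8 * 2 ^ n
low-layers n _ _  (inj₁ refl) = z≤n
low-layers n D n≤ (inj₂ ≤n)   = begin
  D * B * n                     ≤⟨ *-mono-≤ (*-monoˡ-≤ B D≤t) n≤ ⟩
  t * B * (8 * t)               ≡⟨ shuffle t B ⟩
  8 * (t * t * B)               ≡⟨ cong (λ s → 8 * (s * B)) (^-distribˡ-+-* 2 D D) ⟨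
  8 * (2 ^ (D + D) * B)         ≤⟨ *-monoʳ-≤ 8 (*-monoˡ-≤ B (^-monoʳ-≤ 2 (+-mono-≤ D≤t D≤t))) ⟩
  8 * (B * B)                   ≡⟨ cong (8 *_) (^-distribˡ-+-* 2 (t + t) (t + t)) ⟨
  8 * 2 ^ (t + t + (t + t))     ≡⟨ cong (λ s → 8 * 2 ^ s) (four t) ⟩
  8 * 2 ^ (4 * t)               ≤⟨ *-monoʳ-≤ 8 (^-monoʳ-≤ 2 ≤n) ⟩
  8 * 2 ^ n                     ∎
  where
  open ≤-Reasoning
  t = 2 ^ D
  B = 2 ^ (t + t)
  D≤t : D ≤ t
  D≤t = <⇒≤ (n<2^n D)
  shuffle : ∀ t B → t * B * (8 * t) ≡ 8 * (t * t * B)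
  shuffle = solve-∀
  four : ∀ t → t + t + (t + t) ≡ 4 * t
  four = solve-∀

-- The constant is 72 + 288 + 2: 9 times 8 from the low layers, 36 times 8 from the high ones, and 2
-- from the sinks.
count-bound : ∀ n D → n ≤ 8 * 2 ^ D → D ≡ 0 ⊎ 4 * 2 ^ D ≤ n →
              (∑< n (λ d → 3 * κ n D d) + 2) * n ≤ 362 * 2 ^ n
count-bound n D n≤ D-low = begin
  (∑< n f + 2) * n
    ≤⟨ *-monoˡ-≤ n (+-monoˡ-≤ 2 (sum-bound e (sym (m+[n∸m]≡n D≤n)))) ⟩
  (D * (9 * B) + 36 * 2 ^ e + 2) * n
    ≡⟨ expand D B (2 ^ e) n ⟩
  9 * (D * B * n) + 36 * (2 ^ e * n) + 2 * n
    ≤⟨ +-mono-≤ (+-mono-≤ (*-monoʳ-≤ 9 (low-layers n D n≤ D-low))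
                          (*-monoʳ-≤ 36 (*-monoʳ-≤ (2 ^ e) n≤)))
                (*-monoʳ-≤ 2 (<⇒≤ (n<2^n n))) ⟩
  9 * (8 * 2 ^ n) + 36 * (2 ^ e * (8 * 2 ^ D)) + 2 * 2 ^ n
    ≡⟨ cong (λ s → 9 * (8 * 2 ^ n) + s + 2 * 2 ^ n) high ⟩
  9 * (8 * 2 ^ n) + 288 * 2 ^ n + 2 * 2 ^ n
    ≡⟨ collect (2 ^ n) ⟩
  362 * 2 ^ n ∎
  where
  open ≤-Reasoning
  f : ℕ → ℕ
  f d = 3 * κ n D d
  B = 2 ^ (2 ^ D + 2 ^ D)
  e = n ∸ D
  D≤n : D ≤ n
  D≤n = [ (λ { refl → z≤n }) , (λ ≤n → ≤-trans (<⇒≤ (n<2^n D)) (≤-trans (m≤n*m (2 ^ D) 4) ≤n)) ]′ D-low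
  sum-bound : ∀ e → n ≡ D + e → ∑< n f ≤ D * (9 * B) + 36 * 2 ^ e
  sum-bound e refl = ≤-trans (≤-reflexive (∑<-+ D e f))
    (+-mono-≤ (∑<-constant D (κ-low n D)) (∑<-geometric e {c = 36} (κ-high D e)))
  expand : ∀ D B E n → (D * (9 * B) + 36 * E + 2) * n ≡ 9 * (D * B * n) + 36 * (E * n) + 2 * n
  expand = solve-∀
  regroup : ∀ E P → 36 * (E * (8 * P)) ≡ 288 * (P * E)
  regroup = solve-∀
  high : 36 * (2 ^ e * (8 * 2 ^ D)) ≡ 288 * 2 ^ n
  high = trans (regroup (2 ^ e) (2 ^ D)) (cong (288 *_)
    (trans (sym (^-distribˡ-+-* 2 D e)) (cong (2 ^_) (m+[n∸m]≡n D≤n))))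
  collect : ∀ p → 9 * (8 * p) + 288 * p + 2 * p ≡ 362 * p
  collect = solve-∀

-- If the logarithm is `suc l`, then `n < 2 ^ l` would by monotonicity push it down to `l`.
2^⌈log₂n⌉≤2*n : ∀ n .{{_ : NonZero n}} → 2 ^ ⌈log₂ n ⌉ ≤ 2 * n
2^⌈log₂n⌉≤2*n n with ⌈log₂ n ⌉ in eq
... | zero  = ≤-trans (>-nonZero⁻¹ n) (m≤n*m n 2)
... | suc l = *-monoʳ-≤ 2 (≮⇒≥ {n} {2 ^ l} λ n<2^l → <⇒≱ (n<1+n l) (begin
  suc l             ≡⟨ eq ⟨
  ⌈log₂ n ⌉         ≤⟨ ⌈log₂⌉-mono-≤ (<⇒≤ n<2^l) ⟩
  ⌈log₂ 2 ^ l ⌉     ≡⟨ ⌈log₂2^n⌉≡n l ⟩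
  l                 ∎))
  where open ≤-Reasoning

small-obdd : ∀ {N} (G : UnitIntervalGraph N) n →
             Σ[ B ∈ OBDD (Interleaved n) ] Represents B (χ G) × size B * n ≤ 362 * 2 ^ n
small-obdd G n = layered , represents , count-bound n D n≤ D-low
  where
  D = proj₁ (threshold n)
  n≤ = proj₁ (proj₂ (threshold n))
  D-low = proj₂ (proj₂ (threshold n))
  classification : ∀ (e : Fin n) → Classification (symmetrise (reach G))
    (2 ^ suc (toℕ e)) (2 ^ (n ∸ suc (toℕ e))) (κ n D (toℕ e))
  classification e = staircase-classification (reach-staircase G) n D (toℕ e)
  open Layered (symmetrise (reach G)) n (κ n D) classification
  represents : Represents layered (χ G)
  represents x y = subst (OBDD.Reaches layered (assignment x y) _)
    (trans (symmetrise-reach G ∣ x ∣ ∣ y ∣) (sym (χ-adjacent G x y))) (layered-represents x y)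

mainTheorem2 : ∃[ c ] 0 < c ×
    (∀ N → 2 ≤ N → (G : UnitIntervalGraph N) →
    Σ[ B ∈ OBDD (Interleaved ⌈log₂ N ⌉) ]
    IsMinimal B (χ G) × size B * ⌈log₂ N ⌉ ≤ c * N)
mainTheorem2 = 724 , s≤s z≤n , λ N 2≤N G →
  let n = ⌈log₂ N ⌉
      B , represents , bound = small-obdd G n
      M , minimal , M≤B = minimal-obdd B represents
  in M , minimal , (begin
    size M * n       ≤⟨ *-monoˡ-≤ n M≤B ⟩
    size B * n       ≤⟨ bound ⟩
    -- Rounding `N` up to a power of two at most doubles it, whence 724.
    362 * 2 ^ n      ≤⟨ *-monoʳ-≤ 362 (2^⌈log₂n⌉≤2*n N {{>-nonZero (<-trans (s≤s z≤n) 2≤N)}}) ⟩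
    362 * (2 * N)    ≡⟨ *-assoc 362 2 N ⟨
    724 * N          ∎)
  where open ≤-Reasoning
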